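{- Let $t=q_1^{f_1}q_2^{f_2}\cdots q_r^{f_r}$ with $r \ge 1$, $q_1,\dots,q_r$ distinct odd primes and $f_i\geq 1$, and let $p$ be a prime different from all the $q_i$. Let $\phi(z)=z^t$. For $1\le i\le r$ let $\delta_i=\operatorname{ord}_{q_i}(p)$ and $\mu_i=v_{q_i}(p^{\delta_i}-1)$, and let $\Delta=\operatorname{lcm}\{\delta_i\}_{1\le i\le r}$. Fix a positive integer $\delta$ and a tuple $\nu=\langle \nu_1,\dots,\nu_r\rangle$ of non-negative integers such that infinitely many positive integers $n$ satisfy $\gcd(\Delta,n)=\delta$ and $v_{q_i}(n)=\nu_i$ for all $i$. Let $J\subseteq\{1,2,\dots,r\}$ be the maximal subset with $\delta_J\mid\delta$. Then $$\lim_{\substack{n \to \infty\\ \gcd(\Delta,n)=\delta\\ v_{q_i}(n)=\nu_i\ (1\le i\le r)}}\frac{\#\operatorname{Per}\left(\phi, \mathbb{F}_{p^n}\right)}{p^n}=\prod_{j\in J}\frac{1}{q_j^{\mu_j+\nu_j}}.$$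
   Context: For a polynomial $\phi$ with integer coefficients (reduced mod $p$) and a field $K$ of characteristic $p$, $\operatorname{Per}(\phi,K)=\{\alpha\in K : \phi^m(\alpha)=\alpha \text{ for some } m>0\}$, where $\phi^m$ is the $m$-th iterate of $\phi$ under composition. $\mathbb{F}_{p^n}$ is the field with $p^n$ elements. $v_{q}$ denotes $q$-adic valuation, and $\operatorname{ord}_q(p)$ is the smallest positive integer $k$ with $q\mid p^k-1$. For a nonempty subset $I\subseteq\{1,\dots,r\}$, $\delta_I=\operatorname{lcm}\{\delta_i\}_{i\in I}$, and by convention $\delta_\emptyset=1$. Thus the maximal subset $J$ with $\delta_J\mid\delta$ is $J=\{j:\delta_j\mid\delta\}$, which is empty if no $\delta_j$ divides $\delta$; the empty product is $1$. The limit is taken as $n\to\infty$ through the positive integers $n$ satisfying the conditions displayed under the limit sign. -}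

module Defs where

open import Algebra.Apartness.Bundles using (HeytingField; HeytingCommutativeRing)
open import Algebra.Bundles using (CommutativeRing)
import Algebra.Properties.Semiring.Exp as Exp
open import Data.Bool using (true; false)
open import Data.Fin using (Fin; zero; suc; toℕ; fromℕ<)
open import Data.Fin.Properties as Fin using (any?; pigeonhole; toℕ-fromℕ<; toℕ≤pred[n])
open import Data.Fin.Subset using (Subset; _⊆_)
import Data.Integer as ℤ
open import Data.List using (length; filter; allFin)
open import Data.Nat using (ℕ; zero; suc; _+_; _*_; _∸_; _^_; _≤_; _<_; z≤n; s≤s; _≤?_)
open import Data.Nat.Divisibility using (_∣_)
open import Data.Nat.LCM using (lcm)
open import Data.Nat.Primality using (Prime; prime⇒nonZero)
open import Data.Nat.Properties using (m^n≢0; n<1+n; +-assoc; +-comm; m+[n∸m]≡n; <⇒≤; ≤-trans; m<n⇒0<n∸m; m∸n≤m; ≰⇒>)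
open import Data.Product using (∃; ∃-syntax; _×_; _,_)
open import Data.Rational as ℚ using (ℚ; 1ℚ)
open import Data.Vec using ([]; _∷_)
import Function.Endo.Setoid as EndoSetoid
open import Function.Bundles using (Inverse; Func; _⟨$⟩_)
open import Level using (_⊔_) renaming (suc to lsuc)
open import Relation.Binary.Bundles using (Setoid)
open import Relation.Binary.PropositionalEquality as ≡ using (_≡_)
open import Relation.Nullary using (¬_; Dec; yes; no)
open import Relation.Nullary.Decidable using (map′)
import Relation.Binary.Reasoning.Setoid as SetoidReasoning

------------------------------------------------------------------------
-- Arithmetic

IsValuation : (q n v : ℕ) → Set
IsValuation q n v = (q ^ v ∣ n) × ¬ (q ^ suc v ∣ n)

IsOrd : (q p k : ℕ) → Set
IsOrd q p k = 1 ≤ k × q ∣ p ^ k ∸ 1 × (∀ j → 1 ≤ j → q ∣ p ^ j ∸ 1 → k ≤ j)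

-- ⨀ _∙_ ε I x  combines the x i with i ∈ I, and is ε when I is empty.
⨀ : ∀ {a} {A : Set a} → (A → A → A) → A → ∀ {r} → Subset r → (Fin r → A) → A
⨀ _∙_ ε []          x = ε
⨀ _∙_ ε (true ∷ I)  x = x zero ∙ ⨀ _∙_ ε I (λ i → x (suc i))
⨀ _∙_ ε (false ∷ I) x = ⨀ _∙_ ε I (λ i → x (suc i))

lcmOver : ∀ {r} → Subset r → (Fin r → ℕ) → ℕ
lcmOver = ⨀ lcm 1

∏ℕ : ∀ {r} → Subset r → (Fin r → ℕ) → ℕ
∏ℕ = ⨀ _*_ 1

∏ℚ : ∀ {r} → Subset r → (Fin r → ℚ) → ℚ
∏ℚ = ⨀ ℚ._*_ 1ℚ

-- a /[ p-prime ]^ n  is the fraction a / pⁿ; the primality proof supplies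
-- pⁿ ≢ 0.
infix 7 _/[_]^_
_/[_]^_ : ℕ → ∀ {p} → Prime p → ℕ → ℚ
_/[_]^_ a {p} p-prime n = (ℤ.+ a) ℚ./ (p ^ n)
  where instance _ = m^n≢0 p n {{prime⇒nonZero p-prime}}

IsMaximalDividing : ∀ {r} → (Fin r → ℕ) → ℕ → Subset r → Set
IsMaximalDividing δ d J =
  lcmOver J δ ∣ d × (∀ I → lcmOver I δ ∣ d → J ⊆ I → I ⊆ J)

InfinitelyMany : (ℕ → Set) → Set
InfinitelyMany P = ∀ N → ∃[ n ] (N < n × P n)

------------------------------------------------------------------------
-- Periodic points of a self-map of a finite setoid

module _ {c ℓ} {S : Setoid c ℓ} where
  open Setoid S
  open EndoSetoid S using (Endo; ^-homo; ^-cong₂) renaming (_^_ to _^∘_)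

  Periodic : Endo → Carrier → Set ℓ
  Periodic φ α = ∃[ m ] (1 ≤ m × (φ ^∘ m) ⟨$⟩ α ≈ α)

  module _ {q} (finite : Inverse S (≡.setoid (Fin q))) where
    open Inverse finite using (to; from; to-cong; strictlyInverseʳ)

    private
      to-injective : ∀ {x y} → to x ≡ to y → x ≈ y
      to-injective {x} {y} e =
        trans (sym (strictlyInverseʳ x))
              (trans (reflexive (≡.cong from e)) (strictlyInverseʳ y))

      _≈?_ : ∀ x y → Dec (x ≈ y)
      x ≈? y = map′ to-injective to-cong (to x Fin.≟ to y)

      -- By the pigeonhole principle, a periodic point has a period at most q.
      bounded : ∀ φ α → Periodic φ α →
                ∃[ k ] (1 ≤ k × k ≤ q × (φ ^∘ k) ⟨$⟩ α ≈ α)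
      bounded φ α (m , 1≤m , φᵐα≈α) with m ≤? q
      ... | yes m≤q = m , 1≤m , m≤q , φᵐα≈α
      ... | no  m≰q
        with i , j , i<j , e ← pigeonhole {m = q} {n = suc q} (n<1+n q)
                                 (λ i → to ((φ ^∘ toℕ i) ⟨$⟩ α))
        = d , m<n⇒0<n∸m i<j , ≤-trans (m∸n≤m b a) (toℕ≤pred[n] j) , sym (begin
            α                                     ≈⟨ φᵐα≈α ⟨
            (φ ^∘ m) ⟨$⟩ α                        ≈⟨ ^-cong₂ φ (m+[n∸m]≡n a≤m) α ⟨
            (φ ^∘ (a + s)) ⟨$⟩ α                  ≈⟨ ^-homo φ a s α ⟩
            (φ ^∘ s) ⟨$⟩ ((φ ^∘ a) ⟨$⟩ α)         ≈⟨ Func.cong (φ ^∘ s) (to-injective e) ⟩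
            (φ ^∘ s) ⟨$⟩ ((φ ^∘ b) ⟨$⟩ α)         ≈⟨ ^-homo φ b s α ⟨
            (φ ^∘ (b + s)) ⟨$⟩ α                  ≈⟨ ^-cong₂ φ b+s≡m+d α ⟩
            (φ ^∘ (m + d)) ⟨$⟩ α                  ≈⟨ ^-homo φ m d α ⟩
            (φ ^∘ d) ⟨$⟩ ((φ ^∘ m) ⟨$⟩ α)         ≈⟨ Func.cong (φ ^∘ d) φᵐα≈α ⟩
            (φ ^∘ d) ⟨$⟩ α                        ∎)
        where
        open SetoidReasoning S
        a = toℕ i
        b = toℕ j
        d = b ∸ a
        s = m ∸ a
        a≤m : a ≤ m
        a≤m = ≤-trans (toℕ≤pred[n] i) (<⇒≤ (≰⇒> m≰q))
        b+s≡m+d : b + s ≡ m + d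
        b+s≡m+d = ≡.trans (≡.cong (_+ s) (≡.sym (m+[n∸m]≡n (<⇒≤ i<j))))
                 (≡.trans (≡.cong (_+ s) (+-comm a d))
                 (≡.trans (+-assoc d a s)
                 (≡.trans (≡.cong (d +_) (m+[n∸m]≡n a≤m)) (+-comm d m))))

    periodic? : ∀ φ α → Dec (Periodic φ α)
    periodic? φ α = map′
      (λ (i , e) → suc (toℕ i) , s≤s z≤n , e)
      found
      (any? (λ i → ((φ ^∘ suc (toℕ i)) ⟨$⟩ α) ≈? α))
      where
      found : Periodic φ α → ∃ λ (i : Fin q) → (φ ^∘ suc (toℕ i)) ⟨$⟩ α ≈ α
      found per with bounded φ α per
      ... | suc k , _ , k<q , e =
        fromℕ< k<q , trans (^-cong₂ φ (≡.cong suc (toℕ-fromℕ< k<q)) α) e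

    #Periodic : Endo → ℕ
    #Periodic φ = length (filter (λ i → periodic? φ (from i)) (allFin q))

------------------------------------------------------------------------
-- Finite fields

-- Equality and invertibility are decidable because of `finite`, so the
-- apartness relation is inequality, and the Heyting field axioms say that 0 ≉ 1 and that every
-- nonzero element is invertible.
record FiniteField c ℓ₁ ℓ₂ (q : ℕ) : Set (lsuc (c ⊔ ℓ₁ ⊔ ℓ₂)) where
  field
    heytingField : HeytingField c ℓ₁ ℓ₂

  open HeytingField heytingField public using (heytingCommutativeRing)
  open HeytingCommutativeRing heytingCommutativeRing public using (commutativeRing)
  open CommutativeRing commutativeRing public using (setoid; semiring)

  field
    finite : Inverse setoid (≡.setoid (Fin q))

module _ {c ℓ₁ ℓ₂ q} (K : FiniteField c ℓ₁ ℓ₂ q) where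
  open FiniteField K
  open Exp semiring using (^-congˡ) renaming (_^_ to _^ᴷ_)

  power : ℕ → EndoSetoid.Endo setoid
  power t = record { to = _^ᴷ t ; cong = ^-congˡ t }

  #Per : EndoSetoid.Endo setoid → ℕ
  #Per = #Periodic finite

{-# OPTIONS --safe #-}

-- Write pⁿ - 1 = M A, where A collects the prime factors dividing t. In the group K* of order pⁿ - 1,
-- an element is periodic under z ↦ zᵗ exactly when its order is prime to t, that is, when it is an
-- M-th root of unity. There are exactly M of these: X^M - 1 has at most M roots and X^A - 1 at most A,
-- while every nonzero element is the product of an M-th and an A-th root of unity. With the fixed
-- point 0 this makes 1 + M periodic points, and (1 + M) / (1 + M A) differs from 1 / A by less than
-- 1 / pⁿ. By lifting the exponent, the valuation of pⁿ - 1 at qᵢ is μᵢ + νᵢ when δᵢ ∣ n, equivalently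
-- i ∈ J, and 0 otherwise, so A is the product over J.

module Submission where

open import Data.Bool using (true; false)
open import Defs

module Arithmetic where
  open import Data.Fin as Fin using (Fin; zero; suc; toℕ; fromℕ<; punchOut)
  open import Data.Fin.Properties as Fin using (pigeonhole; toℕ-fromℕ<; punchOut-injective; toℕ<n)
  open import Data.Fin.Subset using (Subset; _∈_; _∪_; ⁅_⁆)
  open import Data.Fin.Subset.Properties using (p⊆p∪q; q⊆p∪q; x∈⁅x⁆; x∈p∪q⁻; x∈⁅y⁆⇒x≡y)
  open import Data.Nat
  open import Data.Nat.Coprimality as Coprimality using (Coprime; coprime-divisor; coprime-Bézout)
  open import Data.Nat.Divisibility
  open import Data.Nat.DivMod using (_%_; _/_; m≡m%n+[m/n]*n; m%n<n)
  open import Data.Nat.GCD using (module Bézout)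
  open import Data.Nat.LCM using (m∣lcm[m,n]; n∣lcm[m,n]; lcm-least)
  open import Data.Nat.Primality
  open import Data.Nat.Properties
  open import Data.Nat.Tactic.RingSolver using (solve-∀)
  open import Data.Product using (∃-syntax; _×_; _,_; proj₁; proj₂)
  open import Data.Sum using (inj₁; inj₂; [_,_]′)
  open import Data.Vec.Base using ([]; _∷_; here; there)
  open import Function using (_∘_; id)
  open import Relation.Binary.PropositionalEquality
  open import Relation.Nullary using (¬_; contradiction)

  -- Coprimality and divisibility by primes.

  coprime-* : ∀ {a b m} → Coprime a m → Coprime b m → Coprime (a * b) m
  coprime-* ca cb (d∣ab , d∣m) = cb (coprime-divisor (λ (e∣d , e∣a) → ca (e∣a , ∣-trans e∣d d∣m)) d∣ab , d∣m)

  coprime-^ : ∀ {a m} k → Coprime a m → Coprime (a ^ k) m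
  coprime-^ zero    _ (d∣1 , _) = ∣1⇒≡1 d∣1
  coprime-^ (suc k) c = coprime-* c (coprime-^ k c)

  coprime-*-∣ : ∀ {a b n} → Coprime a b → a ∣ n → b ∣ n → a * b ∣ n
  coprime-*-∣ {a} {b} c (divides-refl k) b∣ka
    with divides-refl l ← coprime-divisor {o = k} (Coprimality.sym c) (subst (b ∣_) (*-comm k a) b∣ka)
    = divides l (trans (*-assoc l b a) (cong (l *_) (*-comm b a)))

  prime∤⇒coprime : ∀ {q m} → Prime q → ¬ (q ∣ m) → Coprime q m
  prime∤⇒coprime q-prime q∤m (d∣q , d∣m) with prime⇒irreducible q-prime d∣q
  ... | inj₁ d≡1  = d≡1
  ... | inj₂ refl = contradiction d∣m q∤m

  prime∤1 : ∀ {q} → Prime q → ¬ (q ∣ 1)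
  prime∤1 q-prime q∣1 with refl ← ∣1⇒≡1 q∣1 = ¬prime[1] q-prime

  prime∤prime : ∀ {p q} → Prime p → Prime q → p ≢ q → ¬ (p ∣ q)
  prime∤prime p-prime q-prime p≢q p∣q with prime⇒irreducible q-prime p∣q
  ... | inj₁ refl = ¬prime[1] p-prime
  ... | inj₂ p≡q  = p≢q p≡q

  prime∤* : ∀ {q m n} → Prime q → ¬ (q ∣ m) → ¬ (q ∣ n) → ¬ (q ∣ m * n)
  prime∤* q-prime q∤m q∤n q∣mn = [ q∤m , q∤n ]′ (euclidsLemma _ _ q-prime q∣mn)

  prime∤^ : ∀ {q m} → Prime q → ¬ (q ∣ m) → ∀ k → ¬ (q ∣ m ^ k)
  prime∤^ q-prime q∤m zero    = prime∤1 q-prime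
  prime∤^ q-prime q∤m (suc k) = prime∤* q-prime q∤m (prime∤^ q-prime q∤m k)

  -- Bézout's identity, its negative coefficient made nonnegative by adding a multiple of m * n.
  coprime-split : ∀ {m n} → 1 ≤ m → 1 ≤ n → Coprime m n →
                  ∃[ x ] ∃[ y ] ∃[ k ] (x * m + y * n ≡ 1 + k * (m * n))
  coprime-split {suc m} {suc n} _ _ c with coprime-Bézout c
  ... | Bézout.+- x y eq = x , y * m , y ,
    trans (cong (_+ y * m * suc n) (sym eq)) (identity y m n)
    where
    identity : ∀ y m n → 1 + y * (1 + n) + y * m * (1 + n) ≡ 1 + y * ((1 + m) * (1 + n))
    identity = solve-∀
  ... | Bézout.-+ x y eq = x * n , y , x ,
    trans (cong (x * n * suc m +_) (sym eq)) (identity x m n)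
    where
    identity : ∀ x m n → x * n * (1 + m) + (1 + x * (1 + m)) ≡ 1 + x * ((1 + m) * (1 + n))
    identity = solve-∀

  -- Products and least common multiples over a set of indices.

  ∣-∏ℕ : ∀ {r} {x : Fin r → ℕ} {J : Subset r} {i : Fin r} → i ∈ J → x i ∣ ∏ℕ J x
  ∣-∏ℕ {J = true  ∷ J} here        = m∣m*n _
  ∣-∏ℕ {x = x} {J = true ∷ J} (there i∈J) = ∣n⇒∣m*n (x zero) (∣-∏ℕ i∈J)
  ∣-∏ℕ {J = false ∷ J} (there i∈J) = ∣-∏ℕ i∈J

  coprime-∏ℕ : ∀ {r} {x : Fin r → ℕ} (J : Subset r) {m : ℕ} → (∀ i → Coprime (x i) m) → Coprime (∏ℕ J x) m
  coprime-∏ℕ []          _ (d∣1 , _) = ∣1⇒≡1 d∣1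
  coprime-∏ℕ (true  ∷ J) c = coprime-* (c zero) (coprime-∏ℕ J (c ∘ suc))
  coprime-∏ℕ (false ∷ J) c = coprime-∏ℕ J (c ∘ suc)

  ∏ℕ-∣ : ∀ {r} {x : Fin r → ℕ} (J : Subset r) {n : ℕ} → (∀ {i j} → i ≢ j → Coprime (x i) (x j)) →
         (∀ {i} → i ∈ J → x i ∣ n) → ∏ℕ J x ∣ n
  ∏ℕ-∣ []          _ _    = 1∣ _
  ∏ℕ-∣ (true  ∷ J) c x∣n  = coprime-*-∣
    (Coprimality.sym (coprime-∏ℕ J (λ _ → c λ ())))
    (x∣n here) (∏ℕ-∣ J (λ i≢j → c (i≢j ∘ Fin.suc-injective)) (x∣n ∘ there))
  ∏ℕ-∣ (false ∷ J) c x∣n  = ∏ℕ-∣ J (λ i≢j → c (i≢j ∘ Fin.suc-injective)) (x∣n ∘ there)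

  ∣-lcmOver : ∀ {r} {x : Fin r → ℕ} {J : Subset r} {i : Fin r} → i ∈ J → x i ∣ lcmOver J x
  ∣-lcmOver {J = true  ∷ J} here        = m∣lcm[m,n] _ _
  ∣-lcmOver {x = x} {J = true  ∷ J} (there i∈J) = ∣-trans (∣-lcmOver i∈J) (n∣lcm[m,n] (x zero) _)
  ∣-lcmOver {J = false ∷ J} (there i∈J) = ∣-lcmOver i∈J

  lcmOver-least : ∀ {r} {x : Fin r → ℕ} (J : Subset r) {n : ℕ} → (∀ {i} → i ∈ J → x i ∣ n) → lcmOver J x ∣ n
  lcmOver-least []          _   = 1∣ _
  lcmOver-least (true  ∷ J) x∣n = lcm-least (x∣n here) (lcmOver-least J (x∣n ∘ there))
  lcmOver-least (false ∷ J) x∣n = lcmOver-least J (x∣n ∘ there)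

  maximal⇒∣ : ∀ {r} {δ : Fin r → ℕ} {d J} → IsMaximalDividing δ d J → ∀ {i} → i ∈ J → δ i ∣ d
  maximal⇒∣ (J∣d , _) i∈J = ∣-trans (∣-lcmOver i∈J) J∣d

  -- Adjoining `i` to `J` keeps the least common multiple a divisor of `d`, so maximality forces `i`
  -- into `J` already.
  ∣⇒maximal : ∀ {r} {δ : Fin r → ℕ} {d J} → IsMaximalDividing δ d J → ∀ {i} → δ i ∣ d → i ∈ J
  ∣⇒maximal {δ = δ} {d} {J} max@(_ , largest) {i} δᵢ∣d =
    largest (J ∪ ⁅ i ⁆) (lcmOver-least (J ∪ ⁅ i ⁆) divides-d) (p⊆p∪q ⁅ i ⁆) (q⊆p∪q J ⁅ i ⁆ (x∈⁅x⁆ i))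
    where
    divides-d : ∀ {j} → j ∈ J ∪ ⁅ i ⁆ → δ j ∣ d
    divides-d j∈ with x∈p∪q⁻ J ⁅ i ⁆ j∈
    ... | inj₁ j∈J = maximal⇒∣ max j∈J
    ... | inj₂ j∈i with refl ← x∈⁅y⁆⇒x≡y i j∈i = δᵢ∣d

  -- Valuations of `a ^ m - 1`.

  isValuation⇒factor : ∀ {q n v} → IsValuation q n v → ∃[ u ] (n ≡ q ^ v * u × ¬ (q ∣ u))
  isValuation⇒factor {q} {v = v} (divides u eq , maximal) = u , trans eq (*-comm u (q ^ v)) , λ where
    (divides-refl w) → maximal (divides w (trans eq (*-assoc w q (q ^ v))))

  factor⇒isValuation : ∀ {q v u} → Prime q → ¬ (q ∣ u) → IsValuation q (q ^ v * u) v
  factor⇒isValuation {q} {v} {u} q-prime q∤u = m∣m*n u , λ q^[1+v]∣ →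
    q∤u (*-cancelˡ-∣ (q ^ v) {{m^n≢0 q v {{prime⇒nonZero q-prime}}}}
      (subst (_∣ q ^ v * u) (*-comm q (q ^ v)) q^[1+v]∣))

  -- The binomial expansion to first order. It exhibits the cofactor of `b` in `(1 + b) ^ m - 1`,
  -- which is congruent to `m` modulo `b`.
  power-expansion₁ : ∀ b m → ∃[ c ] (suc b ^ m ≡ 1 + b * (m + b * c))
  power-expansion₁ b zero = 0 , identity b
    where
    identity : ∀ b → 1 ≡ 1 + b * (0 + b * 0)
    identity = solve-∀
  power-expansion₁ b (suc m) with c , eq ← power-expansion₁ b m =
    m + c + b * c , trans (cong (suc b *_) eq) (identity b m c)
    where
    identity : ∀ b m c → (1 + b) * (1 + b * (m + b * c)) ≡ 1 + b * ((1 + m) + b * (m + c + b * c))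
    identity = solve-∀

  -- For an odd exponent m = 1 + 2k, the binomial coefficient of b² is k m, a multiple of m.
  power-expansion₂ : ∀ b k → ∃[ c ] (suc b ^ (1 + k * 2) ≡ 1 + b * ((1 + k * 2) + b * k * (1 + k * 2) + b * b * c))
  power-expansion₂ b zero = 0 , identity b
    where
    identity : ∀ b → (1 + b) * 1 ≡ 1 + b * (1 + b * 0 * 1 + b * b * 0)
    identity = solve-∀
  power-expansion₂ b (suc k) with c , eq ← power-expansion₂ b k =
    c + (2 * k + 1) * (1 + k * 2) + b * (k * (1 + k * 2) + 2 * c + b * c) ,
    trans (regroup (suc b) (suc b ^ (k * 2)))
      (trans (cong (suc b * suc b *_) eq) (identity b k c))
    where
    regroup : ∀ x y → x * (x * (x * y)) ≡ x * x * (x * y)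
    regroup = solve-∀
    identity : ∀ b k c →
      (1 + b) * (1 + b) * (1 + b * ((1 + k * 2) + b * k * (1 + k * 2) + b * b * c)) ≡
      1 + b * ((3 + k * 2) + b * (1 + k) * (3 + k * 2)
                 + b * b * (c + (2 * k + 1) * (1 + k * 2) + b * (k * (1 + k * 2) + 2 * c + b * c)))
    identity = solve-∀

  odd⇒1+2k : ∀ n → ¬ (2 ∣ n) → ∃[ k ] (n ≡ 1 + k * 2)
  odd⇒1+2k n 2∤n with n % 2 | m%n<n n 2 | m≡m%n+[m/n]*n n 2
  ... | 0 | _ | eq = contradiction (divides (n / 2) eq) 2∤n
  ... | 1 | _ | eq = n / 2 , eq
  ... | suc (suc _) | s≤s (s≤s ()) | _

  -- OneMod q a v says that v is the valuation of a - 1 at q and is positive.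
  record OneMod (q a v : ℕ) : Set where
    constructor oneMod
    field
      unit  : ℕ
      a≡    : a ≡ 1 + q ^ v * unit
      q∣a-1 : q ∣ q ^ v * unit
      q∤u   : ¬ (q ∣ unit)

  module _ {q : ℕ} (q-prime : Prime q) where

    -- With `a = 1 + b`, the expansion gives `a ^ m - 1 = b (m + b c)`. Since `q` divides `b` but
    -- not `m`, the second factor adds nothing to the valuation.
    oneMod-^-coprime : ∀ {a v m} → ¬ (q ∣ m) → OneMod q a v → OneMod q (a ^ m) v
    oneMod-^-coprime {v = v} {m} q∤m (oneMod u refl q∣b q∤u)
      with c , eq ← power-expansion₁ (q ^ v * u) m =
      oneMod (u * w) (trans eq (cong suc (*-assoc (q ^ v) u w)))
        (subst (q ∣_) (*-assoc (q ^ v) u w) (∣m⇒∣m*n w q∣b))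
        (prime∤* q-prime q∤u λ q∣w → q∤m (∣m+n∣m⇒∣n (subst (q ∣_) (+-comm m _) q∣w) (∣m⇒∣m*n c q∣b)))
      where w = m + q ^ v * u * c

    -- With `b = l q`, the cofactor of `b` in `(1 + b) ^ q - 1` is `q (1 + q (l k + l l c))`, which
    -- contains `q` exactly once. Oddness of `q` makes the coefficient of `b` in this cofactor a
    -- multiple of `q`.
    oneMod-^-self : ¬ (2 ∣ q) → ∀ {a v} → OneMod q a v → OneMod q (a ^ q) (suc v)
    oneMod-^-self q-odd {v = v} (oneMod u refl q∣b q∤u)
      with k , q≡ ← odd⇒1+2k q q-odd
      with divides l b≡lq ← q∣b
      with c , eq ← power-expansion₂ (q ^ v * u) k =
      oneMod (u * w) (trans (cong (suc b ^_) q≡) (trans eq (cong suc b*≡)))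
        (∣m⇒∣m*n (u * w) (m∣m*n (q ^ v)))
        (prime∤* q-prime q∤u λ q∣w → prime∤1 q-prime (∣m+n∣m⇒∣n (subst (q ∣_) (+-comm 1 _) q∣w) (m∣m*n _)))
      where
      b = q ^ v * u
      w = 1 + q * (l * k + l * l * c)
      open ≡-Reasoning
      pull-out : ∀ q l k c → q + l * q * k * q + l * q * (l * q) * c ≡ q * (1 + q * (l * k + l * l * c))
      pull-out = solve-∀
      rearrange : ∀ x u q w → x * u * (q * w) ≡ q * x * (u * w)
      rearrange = solve-∀
      b*≡ : b * ((1 + k * 2) + b * k * (1 + k * 2) + b * b * c) ≡ q ^ suc v * (u * w)
      b*≡ = begin
        b * ((1 + k * 2) + b * k * (1 + k * 2) + b * b * c) ≡⟨ cong (λ x → b * (x + b * k * x + b * b * c)) q≡ ⟨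
        b * (q + b * k * q + b * b * c)                     ≡⟨ cong (λ x → b * (q + x * k * q + x * x * c)) b≡lq ⟩
        b * (q + l * q * k * q + l * q * (l * q) * c)       ≡⟨ cong (b *_) (pull-out q l k c) ⟩
        b * (q * w)                                         ≡⟨ rearrange (q ^ v) u q w ⟩
        q ^ suc v * (u * w)                                 ∎

    oneMod-^-primePower : ¬ (2 ∣ q) → ∀ w {a v} → OneMod q a v → OneMod q (a ^ (q ^ w)) (w + v)
    oneMod-^-primePower q-odd zero {a} one = subst (λ x → OneMod q x _) (sym (^-identityʳ a)) one
    oneMod-^-primePower q-odd (suc w) {a} {v} one =
      subst₂ (OneMod q) (^-*-assoc a q (q ^ w)) (+-suc w v)
        (oneMod-^-primePower q-odd w (oneMod-^-self q-odd one))

  -- Multiplicative order modulo a prime and lifting the exponent.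

  ∣power∸1 : ∀ {q a} → 1 ≤ a → q ∣ a ∸ 1 → ∀ m → q ∣ a ^ m ∸ 1
  ∣power∸1 {q} {suc b} _ q∣b m with c , eq ← power-expansion₁ b m =
    subst (λ x → q ∣ x ∸ 1) (sym eq) (∣m⇒∣m*n _ q∣b)

  -- This follows from `x y - 1 = x (y - 1) + (x - 1)`; the identity below is this one with `x` and
  -- `y` replaced by their predecessors.
  ∣*∸1∣∸1⇒∣∸1 : ∀ {q x y} → 1 ≤ x → 1 ≤ y → q ∣ x * y ∸ 1 → q ∣ y ∸ 1 → q ∣ x ∸ 1
  ∣*∸1∣∸1⇒∣∸1 {q} {suc x} {suc y} _ _ q∣xy q∣y = ∣m+n∣m⇒∣n (subst (q ∣_) (identity x y) q∣xy) (∣n⇒∣m*n (suc x) q∣y)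
    where
    identity : ∀ x y → y + x * (1 + y) ≡ (1 + x) * y + x
    identity = solve-∀

  module _ {p q k : ℕ} (p-prime : Prime p) (q-prime : Prime q) (p≢q : p ≢ q) (ord : IsOrd q p k) where

    private
      instance
        p≢0 = prime⇒nonZero p-prime
        k≢0 = >-nonZero (proj₁ ord)
      q∤p^ : ∀ i → ¬ (q ∣ p ^ i)
      q∤p^ = prime∤^ q-prime (prime∤prime q-prime p-prime (p≢q ∘ sym))

    -- If `r` is the remainder of `n` modulo `k`, then `q` also divides `p ^ r - 1`; a nonzero `r`
    -- below `k` would contradict the minimality of `k`.
    order-∣ : ∀ {n} → q ∣ p ^ n ∸ 1 → k ∣ n
    order-∣ {n} q∣ with n % k | m%n<n n k | m≡m%n+[m/n]*n n k
    ... | zero    | _   | n≡ = divides (n / k) n≡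
    ... | r@(suc _) | r<k | n≡ = contradiction (proj₂ (proj₂ ord) r (s≤s z≤n) q∣p^r) (<⇒≱ r<k)
      where
      p^n≡ : p ^ n ≡ p ^ r * (p ^ k) ^ (n / k)
      p^n≡ = trans (cong (p ^_) n≡) (trans (^-distribˡ-+-* p r (n / k * k))
        (cong (p ^ r *_) (trans (cong (p ^_) (*-comm (n / k) k)) (sym (^-*-assoc p k (n / k))))))
      q∣p^r : q ∣ p ^ r ∸ 1
      q∣p^r = ∣*∸1∣∸1⇒∣∸1 (m^n>0 p r) (m^n>0 (p ^ k) {{m^n≢0 p k}} (n / k))
        (subst (λ x → q ∣ x ∸ 1) p^n≡ q∣) (∣power∸1 (m^n>0 p k) (proj₁ (proj₂ ord)) (n / k))

    -- The `q` powers of `p` with exponents from 0 to `q - 1` take only `q - 1` nonzero residues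
    -- modulo `q`. Two of them agree, and the difference of their exponents, which is less than `q`,
    -- bounds the order.
    order<prime : k < q
    order<prime = go q refl
      where
      go : ∀ q′ → q ≡ q′ → k < q′
      go zero refl = contradiction q-prime ¬prime[0]
      go (suc q′) refl = let i , j , i<j , eq = pigeonhole (n<1+n q′) (λ i → punchOut (residue≢0 i)) in
        ≤-<-trans (proj₂ (proj₂ ord) (toℕ j ∸ toℕ i) (m<n⇒0<n∸m i<j) (q∣ i<j (punchOut-injective (residue≢0 i) (residue≢0 j) eq)))
                  (≤-<-trans (m∸n≤m (toℕ j) (toℕ i)) (toℕ<n j))
        where
        residue : Fin (suc q′) → Fin (suc q′)
        residue i = fromℕ< (m%n<n (p ^ toℕ i) (suc q′))
        residue≡ : ∀ i → toℕ (residue i) ≡ p ^ toℕ i % suc q′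
        residue≡ i = toℕ-fromℕ< (m%n<n (p ^ toℕ i) (suc q′))
        residue≢0 : ∀ i → zero ≢ residue i
        residue≢0 i 0≡ = q∤p^ (toℕ i) (m%n≡0⇒n∣m _ _ (trans (sym (residue≡ i)) (cong toℕ (sym 0≡))))
        q∣ : ∀ {i j} → i Fin.< j → residue i ≡ residue j → suc q′ ∣ p ^ (toℕ j ∸ toℕ i) ∸ 1
        q∣ {i} {j} i<j eq = [ (λ q∣p^i → contradiction q∣p^i (q∤p^ (toℕ i))) , id ]′ (euclidsLemma (p ^ toℕ i) s q-prime q∣p^i*s)
          where
          s = p ^ (toℕ j ∸ toℕ i) ∸ 1
          A = p ^ toℕ i / suc q′
          B = p ^ toℕ j / suc q′
          r = p ^ toℕ i % suc q′
          open ≡-Reasoning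
          -- Both sides equal `p ^ j`. Cancelling the common remainder `r` leaves `p ^ i * s` as a
          -- difference of multiples of `q`.
          equation : r + (A * suc q′ + p ^ toℕ i * s) ≡ r + B * suc q′
          equation = begin
            r + (A * suc q′ + p ^ toℕ i * s)            ≡⟨ +-assoc r (A * suc q′) _ ⟨
            r + A * suc q′ + p ^ toℕ i * s              ≡⟨ cong (_+ p ^ toℕ i * s) (m≡m%n+[m/n]*n (p ^ toℕ i) (suc q′)) ⟨
            p ^ toℕ i + p ^ toℕ i * s                   ≡⟨ *-suc (p ^ toℕ i) s ⟨
            p ^ toℕ i * suc s                           ≡⟨ cong (p ^ toℕ i *_) (sym (m+[n∸m]≡n (m^n>0 p (toℕ j ∸ toℕ i)))) ⟨
            p ^ toℕ i * p ^ (toℕ j ∸ toℕ i)             ≡⟨ ^-distribˡ-+-* p (toℕ i) _ ⟨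
            p ^ (toℕ i + (toℕ j ∸ toℕ i))               ≡⟨ cong (p ^_) (m+[n∸m]≡n (<⇒≤ i<j)) ⟩
            p ^ toℕ j                                   ≡⟨ m≡m%n+[m/n]*n (p ^ toℕ j) (suc q′) ⟩
            p ^ toℕ j % suc q′ + B * suc q′             ≡⟨ cong (_+ B * suc q′) (residue≡ j) ⟨
            toℕ (residue j) + B * suc q′                ≡⟨ cong (λ x → toℕ x + B * suc q′) eq ⟨
            toℕ (residue i) + B * suc q′                ≡⟨ cong (_+ B * suc q′) (residue≡ i) ⟩
            r + B * suc q′                              ∎
          q∣p^i*s : suc q′ ∣ p ^ toℕ i * s
          q∣p^i*s = ∣m+n∣m⇒∣n (divides B (+-cancelˡ-≡ r _ _ equation)) (n∣m*n A)

    prime∤order : ¬ (q ∣ k)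
    prime∤order q∣k = <⇒≱ order<prime (∣⇒≤ q∣k)

    -- Write `n = q ^ ν * (m * k)` with `m` prime to `q`. Starting from `p ^ k`, raising to the
    -- power `m` keeps the valuation `μ`, and each of the `ν` further powers `q` adds one.
    lifting-the-exponent : ¬ (2 ∣ q) → ∀ μ ν {n} → IsValuation q (p ^ k ∸ 1) μ → IsValuation q n ν →
                           k ∣ n → IsValuation q (p ^ n ∸ 1) (μ + ν)
    lifting-the-exponent q-odd μ ν {n} val-μ val-ν k∣n
      with u , p^k∸1≡ , q∤u ← isValuation⇒factor {v = μ} val-μ
      with w , refl , q∤w ← isValuation⇒factor {q} {n} {ν} val-ν
      -- Being less than `q`, the order `k` is prime to `q ^ ν`, so it divides the remaining factor
      -- `w` of `n`.
      with divides-refl m ← coprime-divisor {n = q ^ ν} {o = w}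
             (Coprimality.sym (coprime-^ ν (prime∤⇒coprime q-prime prime∤order))) k∣n
      with oneMod u′ p^n≡ _ q∤u′ ← oneMod-^-primePower q-prime q-odd ν
             (oneMod-^-coprime q-prime {m = m} (λ q∣m → q∤w (∣m⇒∣m*n k q∣m))
               (oneMod u (trans (sym (m+[n∸m]≡n (m^n>0 p k))) (cong suc p^k∸1≡)) (subst (q ∣_) p^k∸1≡ (proj₁ (proj₂ ord))) q∤u))
      = subst₂ (IsValuation q)
          (cong (_∸ 1) (trans (sym p^n≡) (trans (cong (_^ (q ^ ν)) (^-*-assoc p k m)) (trans (^-*-assoc p (k * m) (q ^ ν)) (cong (p ^_) (rearrange k m (q ^ ν)))))))
          (+-comm ν μ)
          (factor⇒isValuation {v = ν + μ} q-prime q∤u′)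
      where
      rearrange : ∀ k m x → k * m * x ≡ x * (m * k)
      rearrange = solve-∀

module FiniteFields where
  open Arithmetic using (coprime-^; coprime-split)
  open import Algebra.Apartness.Bundles using (HeytingField)
  open import Algebra.Bundles using (CommutativeRing)
  import Algebra.Properties.CommutativeMonoid.Sum as Sum
  import Algebra.Properties.Ring as RingProperties
  import Algebra.Properties.Semiring.Exp as Exp
  import Algebra.Solver.Ring.NaturalCoefficients.Default as NaturalCoefficients
  open import Data.Fin using (Fin; zero; suc; toℕ)
  open import Data.Fin.Permutation using (Permutation; permutation)
  open import Data.Fin.Properties as Fin using (any?; pigeonhole; punchInᵢ≢i)
  open import Data.List.Base using (List; []; _∷_; _++_; length; map; filter; allFin; replicate; cartesianProductWith)
  open import Data.List.Membership.Propositional using (_∈_)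
  open import Data.List.Membership.Propositional.Properties using (∈-∃++; ∈-++⁺ˡ; ∈-++⁺ʳ; ∈-++⁻; ∈-filter⁺; ∈-filter⁻; ∈-allFin; ∈-cartesianProductWith⁺)
  open import Data.List.Properties using (length-map; length-++; length-replicate; length-tabulate)
  open import Data.List.Relation.Binary.Subset.Propositional using (_⊆_)
  open import Data.List.Relation.Unary.All as All using (All; []; _∷_)
  import Data.List.Relation.Unary.All.Properties as All
  open import Data.List.Relation.Unary.AllPairs as AllPairs using (AllPairs; []; _∷_)
  import Data.List.Relation.Unary.AllPairs.Properties as AllPairs
  open import Data.List.Relation.Unary.Any using (here; there)
  open import Data.List.Relation.Unary.Unique.Propositional using (Unique)
  open import Data.List.Relation.Unary.Unique.Propositional.Properties using (allFin⁺; filter⁺)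
  open import Data.Nat as ℕ using (ℕ; zero; suc; _≤_; _∸_; z≤n; s≤s)
  open import Data.Nat.Coprimality using (Coprime; coprime-Bézout)
  open import Data.Nat.GCD using (module Bézout)
  import Data.Nat.Properties as ℕ
  open import Data.Product using (∃-syntax; _×_; _,_; proj₁; proj₂)
  open import Data.Sum using (inj₁; inj₂)
  open import Data.Vec.Functional using (removeAt)
  open import Function using (_∘_; id)
  open import Function.Bundles using (Inverse; _⟨$⟩_)
  import Function.Endo.Setoid as EndoSetoid
  open import Relation.Binary.Definitions using (Decidable)
  open import Relation.Binary.PropositionalEquality as ≡ using (_≡_; _≢_)
  import Relation.Binary.Reasoning.Setoid as SetoidReasoning
  open import Relation.Nullary using (¬_; Dec; yes; no; contradiction)
  open import Relation.Nullary.Decidable using (map′)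

  -- Counting with lists.

  length-cartesianProductWith : ∀ {a b c} {A : Set a} {B : Set b} {C : Set c} (f : A → B → C) xs ys →
                                length (cartesianProductWith f xs ys) ≡ length xs ℕ.* length ys
  length-cartesianProductWith f []       ys = ≡.refl
  length-cartesianProductWith f (x ∷ xs) ys = ≡.trans (length-++ (map (f x) ys))
    (≡.cong₂ ℕ._+_ (length-map (f x) ys) (length-cartesianProductWith f xs ys))

  unique-⊆⇒length≤ : ∀ {a} {A : Set a} {xs ys : List A} → Unique xs → xs ⊆ ys → length xs ≤ length ys
  unique-⊆⇒length≤ {xs = []}     _           _     = z≤n
  unique-⊆⇒length≤ {xs = x ∷ xs} (x∉xs ∷ xs!) xs⊆ys with as , bs , ≡.refl ← ∈-∃++ (xs⊆ys (here ≡.refl)) =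
    ℕ.≤-trans (s≤s (unique-⊆⇒length≤ xs! ⊆as++bs)) (ℕ.≤-reflexive (≡.sym length≡))
    where
    ⊆as++bs : xs ⊆ as ++ bs
    ⊆as++bs y∈xs with ∈-++⁻ as (xs⊆ys (there y∈xs))
    ... | inj₁ y∈as          = ∈-++⁺ˡ y∈as
    ... | inj₂ (here y≡x)    = contradiction (≡.sym y≡x) (All.lookup x∉xs y∈xs)
    ... | inj₂ (there y∈bs)  = ∈-++⁺ʳ as y∈bs
    length≡ : length (as ++ x ∷ bs) ≡ suc (length (as ++ bs))
    length≡ = ≡.trans (length-++ as) (≡.trans (ℕ.+-suc _ _) (≡.cong suc (≡.sym (length-++ as))))

  -- Roots of monic polynomials.

  -- A monic polynomial is given by the ascending list of its non-leading coefficients.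
  module MonicPolynomial {c ℓ} (R : CommutativeRing c ℓ) where
    open CommutativeRing R
    open NaturalCoefficients commutativeSemiring using (solve; _:+_; _:*_; _:=_)
    open Exp semiring using (_^_)

    eval : List Carrier → Carrier → Carrier
    eval []       x = 1#
    eval (a ∷ as) x = a + x * eval as x

    -- quotient r f is the quotient of a monic f by X - r, as a monic polynomial.
    quotient : Carrier → List Carrier → List Carrier
    quotient r []              = []
    quotient r (a ∷ [])        = []
    quotient r (a ∷ as@(_ ∷ _)) = eval as r ∷ quotient r as

    length-quotient : ∀ r a as → length (quotient r (a ∷ as)) ≡ length as
    length-quotient r a []        = ≡.refl
    length-quotient r a (b ∷ as) = ≡.cong suc (length-quotient r b as)

    -- The identity f x - f r = (x - r) * quotient, with both sides moved so that no subtraction occurs.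
    eval-quotient : ∀ r a as x → let e = eval (quotient r (a ∷ as)) x in
                    eval (a ∷ as) x + r * e ≈ eval (a ∷ as) r + x * e
    eval-quotient r a [] x = solve 4 (λ a x r u → (a :+ x :* u) :+ r :* u := (a :+ r :* u) :+ x :* u) refl a x r 1#
    eval-quotient r a as@(b ∷ bs) x = begin
      a + x * eval as x + r * (eval as r + x * e)    ≈⟨ rearrange a x (eval as x) r (eval as r) e ⟩
      a + r * eval as r + x * (eval as x + r * e)    ≈⟨ +-congˡ (*-congˡ (eval-quotient r b bs x)) ⟩
      a + r * eval as r + x * (eval as r + x * e)    ∎
      where
      open SetoidReasoning setoid
      e = eval (quotient r as) x
      rearrange : ∀ a x f r g e → a + x * f + r * (g + x * e) ≈ a + r * g + x * (f + r * e)
      rearrange = solve 6 (λ a x f r g e → a :+ x :* f :+ r :* (g :+ x :* e) := a :+ r :* g :+ x :* (f :+ r :* e)) refl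

    eval-replicate-0 : ∀ k x → eval (replicate k 0#) x ≈ x ^ k
    eval-replicate-0 zero    x = refl
    eval-replicate-0 (suc k) x = trans (+-identityˡ _) (*-congˡ (eval-replicate-0 k x))

    module _ (_≈?_ : Decidable _≈_) (1≉0 : ¬ 1# ≈ 0#)
             (*-cancelʳ : ∀ {x y e} → ¬ e ≈ 0# → x * e ≈ y * e → x ≈ y) where

      -- Induction on the degree. Dividing by `X - r` lowers it by one, and a root `x` distinct from
      -- `r` is a root of the quotient: otherwise the value `e` of the quotient at `x` could be
      -- cancelled from `r * e ≈ x * e`.
      length-roots≤degree : ∀ f {xs} → AllPairs (λ x y → ¬ x ≈ y) xs → All (λ x → eval f x ≈ 0#) xs → length xs ≤ length f
      length-roots≤degree f        []         _                = z≤n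
      length-roots≤degree []       (_ ∷ _)    (1≈0 ∷ _)        = contradiction 1≈0 1≉0
      length-roots≤degree (a ∷ as) {r ∷ xs} (r≉xs ∷ distinct) (fr≈0 ∷ fxs≈0) =
        s≤s (≡.subst (length xs ≤_) (length-quotient r a as)
          (length-roots≤degree (quotient r (a ∷ as)) distinct (All.zipWith root (r≉xs , fxs≈0))))
        where
        root : ∀ {x} → ¬ r ≈ x × eval (a ∷ as) x ≈ 0# → eval (quotient r (a ∷ as)) x ≈ 0#
        root {x} (r≉x , fx≈0) with eval (quotient r (a ∷ as)) x ≈? 0#
        ... | yes e≈0 = e≈0
        ... | no  e≉0 = contradiction (*-cancelʳ e≉0 re≈xe) r≉x
          where
          e = eval (quotient r (a ∷ as)) x
          open SetoidReasoning setoid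
          re≈xe : r * e ≈ x * e
          re≈xe = begin
            r * e                  ≈⟨ +-identityˡ _ ⟨
            0# + r * e             ≈⟨ +-congʳ fx≈0 ⟨
            eval (a ∷ as) x + r * e ≈⟨ eval-quotient r a as x ⟩
            eval (a ∷ as) r + x * e ≈⟨ +-congʳ fr≈0 ⟩
            0# + x * e             ≈⟨ +-identityˡ _ ⟩
            x * e                  ∎

  -- Arithmetic in a finite field with `suc n` elements.

  module FiniteFieldProperties {c ℓ₁ ℓ₂ n} (K : FiniteField c ℓ₁ ℓ₂ (suc n)) where
    open FiniteField K hiding (setoid; semiring)
    open HeytingField heytingField using (_#_; #-irrefl; #⇒invertible; invertible⇒#; tight)
    open CommutativeRing commutativeRing hiding (zero)
    open Exp semiring
    open RingProperties ring using (-0#≈0#)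
    open Inverse finite using (to; from; to-cong; from-cong; strictlyInverseˡ; strictlyInverseʳ)
    open SetoidReasoning setoid

    to-injective : ∀ {x y} → to x ≡ to y → x ≈ y
    to-injective {x} {y} e = trans (sym (strictlyInverseʳ x)) (trans (from-cong e) (strictlyInverseʳ y))

    _≈?_ : Decidable _≈_
    x ≈? y = map′ to-injective to-cong (to x Fin.≟ to y)

    from-to≈ : ∀ {x y} → x ≈ y → from (to x) ≈ y
    from-to≈ x≈y = trans (strictlyInverseʳ _) x≈y

    -- If 1 were 0, then `0# - 0#` would be invertible, so 0 would be apart from itself.
    1≉0 : ¬ 1# ≈ 0#
    1≉0 1≈0 = #-irrefl refl (invertible⇒# (0# , 0*≈1 , trans (*-comm _ _) 0*≈1))
      where
      0*≈1 : 0# * (0# - 0#) ≈ 1#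
      0*≈1 = trans (zeroˡ _) (sym 1≈0)

    -- The search through all elements is decidable. If it fails, `x` cannot be apart from 0, and
    -- tightness of the apartness relation makes `x` equal to 0.
    inverse : ∀ {x} → ¬ x ≈ 0# → ∃[ y ] (y * x ≈ 1#)
    inverse {x} x≉0 with any? (λ i → (from i * x) ≈? 1#)
    ... | yes (i , eq) = from i , eq
    ... | no  none = contradiction (proj₁ (tight x 0#) ¬x#0) x≉0
      where
      ¬x#0 : ¬ (x # 0#)
      ¬x#0 x#0 with y , yx≈1 , _ ← #⇒invertible x#0 = none (to y , (begin
        from (to y) * x  ≈⟨ *-congʳ (strictlyInverseʳ y) ⟩
        y * x            ≈⟨ *-congˡ (+-identityʳ x) ⟨
        y * (x + 0#)     ≈⟨ *-congˡ (+-congˡ -0#≈0#) ⟨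
        y * (x - 0#)     ≈⟨ yx≈1 ⟩
        1#               ∎))

    *-cancelˡ-nonzero : ∀ {x y z} → ¬ x ≈ 0# → x * y ≈ x * z → y ≈ z
    *-cancelˡ-nonzero {x} {y} {z} x≉0 xy≈xz with u , ux≈1 ← inverse x≉0 = begin
      y            ≈⟨ *-identityˡ y ⟨
      1# * y       ≈⟨ *-congʳ ux≈1 ⟨
      u * x * y    ≈⟨ *-assoc u x y ⟩
      u * (x * y)  ≈⟨ *-congˡ xy≈xz ⟩
      u * (x * z)  ≈⟨ *-assoc u x z ⟨
      u * x * z    ≈⟨ *-congʳ ux≈1 ⟩
      1# * z       ≈⟨ *-identityˡ z ⟩
      z            ∎

    *-cancelʳ-nonzero : ∀ {x y z} → ¬ z ≈ 0# → x * z ≈ y * z → x ≈ y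
    *-cancelʳ-nonzero z≉0 xz≈yz = *-cancelˡ-nonzero z≉0 (trans (*-comm _ _) (trans xz≈yz (*-comm _ _)))

    *-nonzero : ∀ {x y} → ¬ x ≈ 0# → ¬ y ≈ 0# → ¬ x * y ≈ 0#
    *-nonzero x≉0 y≉0 xy≈0 = y≉0 (*-cancelˡ-nonzero x≉0 (trans xy≈0 (sym (zeroʳ _))))

    xy≈x⇒y≈1 : ∀ {x y} → ¬ x ≈ 0# → x * y ≈ x → y ≈ 1#
    xy≈x⇒y≈1 x≉0 xy≈x = *-cancelˡ-nonzero x≉0 (trans xy≈x (sym (*-identityʳ _)))

    ^-nonzero : ∀ {x} → ¬ x ≈ 0# → ∀ k → ¬ x ^ k ≈ 0#
    ^-nonzero x≉0 zero    = 1≉0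
    ^-nonzero x≉0 (suc k) = *-nonzero x≉0 (^-nonzero x≉0 k)

    0^≈0 : ∀ {x} k → 1 ≤ k → x ≈ 0# → x ^ k ≈ 0#
    0^≈0 (suc k) _ x≈0 = trans (*-congʳ x≈0) (zeroˡ _)

    1^≈1 : ∀ {x} k → x ≈ 1# → x ^ k ≈ 1#
    1^≈1 zero    _   = refl
    1^≈1 (suc k) x≈1 = trans (*-cong x≈1 (1^≈1 k x≈1)) (*-identityˡ 1#)

    ^-multiple : ∀ x a k → x ^ a ≈ 1# → x ^ (a ℕ.* k) ≈ 1#
    ^-multiple x a k x^a≈1 = trans (sym (^-assocʳ x a k)) (1^≈1 k x^a≈1)

    ^-combine : ∀ {x a b} u v → x ^ a ≈ 1# → x ^ b ≈ 1# → 1 ℕ.+ u ℕ.* a ≡ v ℕ.* b → x ≈ 1#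
    ^-combine {x} {a} {b} u v x^a≈1 x^b≈1 eq = begin
      x                     ≈⟨ *-identityʳ x ⟨
      x * 1#                ≈⟨ *-congˡ (^-multiple x a u x^a≈1) ⟨
      x ^ (1 ℕ.+ a ℕ.* u)   ≡⟨ ≡.cong (λ k → x ^ suc k) (ℕ.*-comm a u) ⟩
      x ^ (1 ℕ.+ u ℕ.* a)   ≡⟨ ≡.cong (x ^_) eq ⟩
      x ^ (v ℕ.* b)         ≡⟨ ≡.cong (x ^_) (ℕ.*-comm v b) ⟩
      x ^ (b ℕ.* v)         ≈⟨ ^-multiple x b v x^b≈1 ⟩
      1#                    ∎

    -- By Bézout's identity, 1 is a difference of multiples of `a` and `b`; the two sign cases
    -- exchange the roles of the exponents.
    ^-coprime : ∀ {x a b} → Coprime a b → x ^ a ≈ 1# → x ^ b ≈ 1# → x ≈ 1#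
    ^-coprime c x^a≈1 x^b≈1 with coprime-Bézout c
    ... | Bézout.+- u v eq = ^-combine v u x^b≈1 x^a≈1 eq
    ... | Bézout.-+ u v eq = ^-combine u v x^a≈1 x^b≈1 eq

    -- Products over the field and the identity `x ^ suc n ≈ x`.

    private
      module ∏ = Sum *-commutativeMonoid

    ∏-nonzero : ∀ {k} (f : Fin k → Carrier) → (∀ i → ¬ f i ≈ 0#) → ¬ ∏.sum f ≈ 0#
    ∏-nonzero {zero}  f f≉0 = 1≉0
    ∏-nonzero {suc k} f f≉0 = *-nonzero (f≉0 zero) (∏-nonzero (f ∘ suc) (f≉0 ∘ suc))

    ∏-indicator : ∀ {k} (z : Fin (suc k)) (f : Fin (suc k) → Carrier) → (∀ i → i ≢ z → f i ≈ 1#) → ∏.sum f ≈ f z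
    ∏-indicator {k} z f f≈1 = begin
      ∏.sum f                          ≈⟨ ∏.sum-remove {i = z} f ⟩
      f z * ∏.sum (removeAt f z)       ≈⟨ *-congˡ (∏.sum-cong-≋ (λ j → f≈1 _ (punchInᵢ≢i z j))) ⟩
      f z * ∏.sum (λ (_ : Fin k) → 1#) ≈⟨ *-congˡ (∏.sum-replicate-zero k) ⟩
      f z * 1#                         ≈⟨ *-identityʳ _ ⟩
      f z                              ∎

    private
      -- The decision is an argument, so that a `with` on `from i ≈? 0#` reduces the factors `f i`
      -- and `e i` defined through it.
      choose : ∀ {x : Carrier} → Dec (x ≈ 0#) → Carrier → Carrier → Carrier
      choose (yes _) a b = a
      choose (no  _) a b = b

    -- Multiplication by g ≉ 0 permutes K; compare the products of all nonzero elements. In f the factor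
    -- at 0 is replaced by 1, and e corrects for the factor g that is then missing there.
    x^cardinality≈x : ∀ g → g ^ suc n ≈ g
    x^cardinality≈x g with g ≈? 0#
    ... | yes g≈0 = trans (0^≈0 (suc n) (s≤s z≤n) g≈0) (sym g≈0)
    ... | no  g≉0 with h , hg≈1 ← inverse g≉0 = *-cancelʳ-nonzero (∏-nonzero f f≉0) (begin
      g ^ suc n * ∏.sum f                   ≈⟨ *-congʳ (∏.sum-replicate (suc n)) ⟨
      ∏.sum {suc n} (λ _ → g) * ∏.sum f     ≈⟨ ∏.∑-distrib-+ (λ _ → g) f ⟨
      ∏.sum (λ i → g * f i)                 ≈⟨ ∏.sum-cong-≋ shift ⟩
      ∏.sum (λ i → e i * f (shiftIndex i))  ≈⟨ ∏.∑-distrib-+ e (f ∘ shiftIndex) ⟩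
      ∏.sum e * ∏.sum (f ∘ shiftIndex)      ≈⟨ *-cong (trans (∏-indicator (to 0#) e e≈1) e≈g) (sym (∏.sum-permute f π)) ⟩
      g * ∏.sum f                           ∎)
      where
      shiftIndex : Fin (suc n) → Fin (suc n)
      shiftIndex i = to (g * from i)

      cancel : ∀ {a b} → a * b ≈ 1# → ∀ i → to (a * from (to (b * from i))) ≡ i
      cancel {a} {b} ab≈1 i = ≡.trans (to-cong (begin
        a * from (to (b * from i)) ≈⟨ *-congˡ (strictlyInverseʳ _) ⟩
        a * (b * from i)           ≈⟨ *-assoc a b _ ⟨
        a * b * from i             ≈⟨ *-congʳ ab≈1 ⟩
        1# * from i                ≈⟨ *-identityˡ _ ⟩
        from i                     ∎)) (strictlyInverseˡ i)

      π : Permutation (suc n) (suc n)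
      π = permutation shiftIndex (λ i → to (h * from i)) (cancel (trans (*-comm g h) hg≈1)) (cancel hg≈1)

      f e : Fin (suc n) → Carrier
      f i = choose (from i ≈? 0#) 1# (from i)
      e i = choose (from i ≈? 0#) g 1#

      f≉0 : ∀ i → ¬ f i ≈ 0#
      f≉0 i with from i ≈? 0#
      ... | yes _   = 1≉0
      ... | no  x≉0 = x≉0

      e≈g : e (to 0#) ≈ g
      e≈g with from (to 0#) ≈? 0#
      ... | yes _ = refl
      ... | no ≉0 = contradiction (strictlyInverseʳ 0#) ≉0

      e≈1 : ∀ i → i ≢ to 0# → e i ≈ 1#
      e≈1 i i≢ with from i ≈? 0#
      ... | yes ≈0 = contradiction (≡.trans (≡.sym (strictlyInverseˡ i)) (to-cong ≈0)) i≢
      ... | no _   = refl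

      -- At the index of 0 both sides are `g * 1#` up to order, and elsewhere both are `g * from i`.
      -- The mixed cases are impossible because multiplication by `g` preserves being zero and being
      -- nonzero.
      shift : ∀ i → g * f i ≈ e i * f (shiftIndex i)
      shift i with from i ≈? 0# | from (shiftIndex i) ≈? 0#
      ... | yes _   | yes _   = refl
      ... | yes i≈0 | no  ≉0  = contradiction (from-to≈ (trans (*-congˡ i≈0) (zeroʳ g))) ≉0
      ... | no  i≉0 | yes ≈0  = contradiction (trans (sym (strictlyInverseʳ _)) ≈0) (*-nonzero g≉0 i≉0)
      ... | no  _   | no  _   = sym (trans (*-identityˡ _) (strictlyInverseʳ _))

    x^n≈1 : ∀ {x} → ¬ x ≈ 0# → x ^ n ≈ 1#
    x^n≈1 {x} x≉0 = xy≈x⇒y≈1 x≉0 (x^cardinality≈x x)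

    torsion-nonzero : ∀ {x} k → 1 ≤ k → x ^ k ≈ 1# → ¬ x ≈ 0#
    torsion-nonzero k 1≤k x^k≈1 x≈0 = 1≉0 (trans (sym x^k≈1) (0^≈0 k 1≤k x≈0))

    -- Iterates of the power map and roots of unity.

    open EndoSetoid setoid using () renaming (_^_ to _^∘_)

    power-iterate : ∀ t m x → (power K t ^∘ m) ⟨$⟩ x ≈ x ^ (t ℕ.^ m)
    power-iterate t zero    x = sym (*-identityʳ x)
    power-iterate t (suc m) x = trans (power-iterate t m (x ^ t)) (^-assocʳ x t (t ℕ.^ m))

    0-periodic : ∀ {t x} → 1 ≤ t → x ≈ 0# → Periodic (power K t) x
    0-periodic {t} {x} 1≤t x≈0 = 1 , s≤s z≤n ,
      trans (power-iterate t 1 x) (trans (0^≈0 (t ℕ.^ 1) (≡.subst (1 ≤_) (≡.sym (ℕ.*-identityʳ t)) 1≤t) x≈0) (sym x≈0))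

    -- The `k`-th roots of unity, listed by index so that membership and uniqueness refer to
    -- propositional equality.
    torsion : ℕ → List (Fin (suc n))
    torsion k = filter (λ i → (from i ^ k) ≈? 1#) (allFin (suc n))

    ∈-torsion⁺ : ∀ {x} k → x ^ k ≈ 1# → to x ∈ torsion k
    ∈-torsion⁺ {x} k x^k≈1 = ∈-filter⁺ (λ i → (from i ^ k) ≈? 1#) (∈-allFin (to x))
      (trans (^-congˡ k (strictlyInverseʳ x)) x^k≈1)

    ∈-torsion⁻ : ∀ {i} k → i ∈ torsion k → from i ^ k ≈ 1#
    ∈-torsion⁻ k i∈ = proj₂ (∈-filter⁻ (λ i → (from i ^ k) ≈? 1#) {xs = allFin (suc n)} i∈)

    torsion-unique : ∀ k → Unique (torsion k)
    torsion-unique k = filter⁺ (λ i → (from i ^ k) ≈? 1#) (allFin⁺ (suc n))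

    -- The members are distinct roots of `X^k-1`, whose non-leading coefficients are -1 followed by
    -- `k - 1` zeros.
    length-torsion≤ : ∀ k → 1 ≤ k → length (torsion k) ≤ k
    length-torsion≤ k@(suc k-1) _ = ≡.subst₂ _≤_ (length-map from (torsion k)) (≡.cong suc (length-replicate k-1))
      (length-roots≤degree _≈?_ 1≉0 *-cancelʳ-nonzero X^k-1
        (AllPairs.map⁺ (AllPairs.map from-injective (torsion-unique k)))
        (All.map⁺ (All.tabulate (root ∘ ∈-torsion⁻ k))))
      where
      open MonicPolynomial commutativeRing
      X^k-1 = - 1# ∷ replicate k-1 0#
      from-injective : ∀ {i j} → i ≢ j → ¬ from i ≈ from j
      from-injective i≢j e = i≢j (≡.trans (≡.sym (strictlyInverseˡ _)) (≡.trans (to-cong e) (strictlyInverseˡ _)))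
      root : ∀ {x} → x ^ k ≈ 1# → eval X^k-1 x ≈ 0#
      root {x} x^k≈1 = begin
        - 1# + x * eval (replicate k-1 0#) x ≈⟨ +-congˡ (*-congˡ (eval-replicate-0 k-1 x)) ⟩
        - 1# + x ^ k                         ≈⟨ +-congˡ x^k≈1 ⟩
        - 1# + 1#                            ≈⟨ -‿inverseˡ 1# ⟩
        0#                                   ∎

    -- The exact number of `M`-th roots of unity.

    module _ {M A : ℕ} (n≡M*A : n ≡ M ℕ.* A) (1≤M : 1 ≤ M) (1≤A : 1 ≤ A) (coprime : Coprime M A) where

      x^[M*A]≈1 : ∀ {x} → ¬ x ≈ 0# → x ^ (M ℕ.* A) ≈ 1#
      x^[M*A]≈1 {x} x≉0 = trans (^-congʳ x (≡.sym n≡M*A)) (x^n≈1 x≉0)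

      -- From `u M + v A = 1 + k M A` and `x ^ (M A) ≈ 1` it follows that `x` is the product of
      -- `x ^ (v A)` and `x ^ (u M)`.
      torsion-decomposition : ∀ {x} → ¬ x ≈ 0# → ∃[ y ] ∃[ z ] (y ^ M ≈ 1# × z ^ A ≈ 1# × y * z ≈ x)
      torsion-decomposition {x} x≉0 with u , v , k , eq ← coprime-split 1≤M 1≤A coprime =
        x ^ (v ℕ.* A) , x ^ (u ℕ.* M) ,
        trans (^-assocʳ x (v ℕ.* A) M) (trans (^-congʳ x (vA*M v)) (^-multiple x (M ℕ.* A) v (x^[M*A]≈1 x≉0))) ,
        trans (^-assocʳ x (u ℕ.* M) A) (trans (^-congʳ x (uM*A u)) (^-multiple x (M ℕ.* A) u (x^[M*A]≈1 x≉0))) ,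
        (begin
          x ^ (v ℕ.* A) * x ^ (u ℕ.* M)       ≈⟨ *-comm _ _ ⟩
          x ^ (u ℕ.* M) * x ^ (v ℕ.* A)       ≈⟨ ^-homo-* x (u ℕ.* M) (v ℕ.* A) ⟨
          x ^ (u ℕ.* M ℕ.+ v ℕ.* A)           ≡⟨ ≡.cong (x ^_) eq ⟩
          x * x ^ (k ℕ.* (M ℕ.* A))           ≡⟨ ≡.cong (λ l → x * x ^ l) (ℕ.*-comm k (M ℕ.* A)) ⟩
          x * x ^ (M ℕ.* A ℕ.* k)             ≈⟨ *-congˡ (^-multiple x (M ℕ.* A) k (x^[M*A]≈1 x≉0)) ⟩
          x * 1#                              ≈⟨ *-identityʳ x ⟩
          x                                   ∎)
        where
        uM*A : ∀ u → u ℕ.* M ℕ.* A ≡ M ℕ.* A ℕ.* u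
        uM*A u = ≡.trans (ℕ.*-assoc u M A) (ℕ.*-comm u _)
        vA*M : ∀ v → v ℕ.* A ℕ.* M ≡ M ℕ.* A ℕ.* v
        vA*M v = ≡.trans (ℕ.*-assoc v A M) (≡.trans (ℕ.*-comm v _) (≡.cong (ℕ._* v) (ℕ.*-comm A M)))

      -- Let `T` be the number of `M`-th roots of unity. Covering the field by 0 and the products of
      -- roots gives `1 + M A ≤ 1 + T A`, hence `M ≤ T`; the reverse bound comes from the degree.
      length-torsion : length (torsion M) ≡ M
      length-torsion = ℕ.≤-antisym (length-torsion≤ M 1≤M)
        (ℕ.*-cancelʳ-≤ M (length (torsion M)) A {{ℕ.>-nonZero 1≤A}} (ℕ.s≤s⁻¹ (ℕR.begin
          suc (M ℕ.* A)                                             ℕR.≡⟨ ≡.cong suc n≡M*A ⟨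
          suc n                                                     ℕR.≡⟨ length-tabulate id ⟨
          length (allFin (suc n))                                   ℕR.≤⟨ unique-⊆⇒length≤ (allFin⁺ (suc n)) cover ⟩
          suc (length (cartesianProductWith product (torsion M) (torsion A)))
            ℕR.≡⟨ ≡.cong suc (length-cartesianProductWith product (torsion M) (torsion A)) ⟩
          suc (length (torsion M) ℕ.* length (torsion A))           ℕR.≤⟨ s≤s (ℕ.*-monoʳ-≤ (length (torsion M)) (length-torsion≤ A 1≤A)) ⟩
          suc (length (torsion M) ℕ.* A)                            ℕR.∎)))
        where
        module ℕR = ℕ.≤-Reasoning
        product : Fin (suc n) → Fin (suc n) → Fin (suc n)
        product i j = to (from i * from j)
        cover : allFin (suc n) ⊆ to 0# ∷ cartesianProductWith product (torsion M) (torsion A)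
        cover {i} _ with from i ≈? 0#
        ... | yes ≈0 = here (≡.trans (≡.sym (strictlyInverseˡ i)) (to-cong ≈0))
        ... | no  ≉0 with y , z , y^M≈1 , z^A≈1 , yz≈ ← torsion-decomposition ≉0 = there
          (≡.subst (_∈ _)
            (≡.trans (to-cong (trans (*-cong (strictlyInverseʳ y) (strictlyInverseʳ z)) yz≈)) (strictlyInverseˡ i))
            (∈-cartesianProductWith⁺ product {xs = torsion M} {ys = torsion A} (∈-torsion⁺ M y^M≈1) (∈-torsion⁺ A z^A≈1)))

      -- Periodic points of the power map.

      module _ {t : ℕ} (1≤t : 1 ≤ t) (coprime-t-M : Coprime t M)
               (coprime-A : ∀ m → 1 ≤ m → Coprime (t ℕ.^ m ∸ 1) A) where

        private
          φ = power K t
          instance _ = ℕ.>-nonZero 1≤t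

          x^t^k : ∀ x k → x ^ (t ℕ.^ k) ≈ x * x ^ (t ℕ.^ k ∸ 1)
          x^t^k x k = ^-congʳ x (≡.sym (ℕ.m+[n∸m]≡n (ℕ.m^n>0 t k)))

        -- A nonzero point of period `m` satisfies `x ^ e ≈ 1` with `e = t ^ m - 1`. Thus `x ^ M` is
        -- killed by the coprime exponents `e` and `A`, and equals 1.
        periodic⇒torsion : ∀ {x} → ¬ x ≈ 0# → Periodic φ x → x ^ M ≈ 1#
        periodic⇒torsion {x} x≉0 (m , 1≤m , φᵐx≈x) = ^-coprime (coprime-A m 1≤m) x^M^e≈1 (trans (^-assocʳ x M A) (x^[M*A]≈1 x≉0))
          where
          e = t ℕ.^ m ∸ 1
          x^e≈1 : x ^ e ≈ 1#
          x^e≈1 = xy≈x⇒y≈1 x≉0 (trans (sym (x^t^k x m)) (trans (sym (power-iterate t m x)) φᵐx≈x))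
          x^M^e≈1 : (x ^ M) ^ e ≈ 1#
          x^M^e≈1 = trans (^-assocʳ x M e) (trans (^-congʳ x (ℕ.*-comm M e)) (^-multiple x e M x^e≈1))

        -- Two iterates agree by the pigeonhole principle, so with `e = t ^ k - 1` the element
        -- `x ^ e` is killed by a power of `t`. It is also killed by `M`, which is prime to `t`;
        -- hence `x ^ e ≈ 1` and `k` is a period.
        torsion⇒periodic : ∀ {x} → x ^ M ≈ 1# → Periodic φ x
        torsion⇒periodic {x} x^M≈1
          with i , j , i<j , eq ← pigeonhole (ℕ.n<1+n (suc n)) (λ i → to (x ^ (t ℕ.^ toℕ i))) =
          k , ℕ.m<n⇒0<n∸m i<j , trans (power-iterate t k x) (trans (x^t^k x k) (trans (*-congˡ x^e≈1) (*-identityʳ x)))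
          where
          a = t ℕ.^ toℕ i
          k = toℕ j ∸ toℕ i
          e = t ℕ.^ k ∸ 1
          [x^e]^a≈1 : (x ^ e) ^ a ≈ 1#
          [x^e]^a≈1 = xy≈x⇒y≈1 (^-nonzero (torsion-nonzero M 1≤M x^M≈1) a) (begin
            x ^ a * (x ^ e) ^ a        ≈⟨ *-congˡ (^-assocʳ x e a) ⟩
            x ^ a * x ^ (e ℕ.* a)      ≈⟨ ^-homo-* x a (e ℕ.* a) ⟨
            x ^ (suc e ℕ.* a)          ≡⟨ ≡.cong (λ l → x ^ (l ℕ.* a)) (≡.sym (ℕ.m+[n∸m]≡n (ℕ.m^n>0 t k))) ⟨
            x ^ (t ℕ.^ k ℕ.* a)        ≡⟨ ≡.cong (x ^_) (ℕ.^-distribˡ-+-* t k (toℕ i)) ⟨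
            x ^ (t ℕ.^ (k ℕ.+ toℕ i))  ≡⟨ ≡.cong (λ l → x ^ (t ℕ.^ l)) (ℕ.m∸n+n≡m (ℕ.<⇒≤ i<j)) ⟩
            x ^ (t ℕ.^ toℕ j)          ≈⟨ to-injective eq ⟨
            x ^ a                      ∎)
          [x^e]^M≈1 : (x ^ e) ^ M ≈ 1#
          [x^e]^M≈1 = trans (^-assocʳ x e M) (trans (^-congʳ x (ℕ.*-comm e M)) (^-multiple x M e x^M≈1))
          x^e≈1 : x ^ e ≈ 1#
          x^e≈1 = ^-coprime (coprime-^ (toℕ i) coprime-t-M) [x^e]^a≈1 [x^e]^M≈1

        -- The list of periodic points and the list of 0 with the `M`-th roots of unity are free of
        -- repetitions and contain each other.
        #Per-power : #Per K φ ≡ suc M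
        #Per-power = ≡.trans (ℕ.≤-antisym
            (unique-⊆⇒length≤ (filter⁺ P? (allFin⁺ (suc n))) ⊆-torsion)
            (unique-⊆⇒length≤ (All.tabulate 0∉torsion ∷ torsion-unique M) torsion-⊆))
          (≡.cong suc length-torsion)
          where
          P? = λ i → periodic? finite φ (from i)
          periodicPoints = filter P? (allFin (suc n))
          ⊆-torsion : periodicPoints ⊆ to 0# ∷ torsion M
          ⊆-torsion {i} i∈ with from i ≈? 0#
          ... | yes ≈0 = here (≡.trans (≡.sym (strictlyInverseˡ i)) (to-cong ≈0))
          ... | no  ≉0 = there (≡.subst (_∈ torsion M) (strictlyInverseˡ i)
            (∈-torsion⁺ M (periodic⇒torsion ≉0 (proj₂ (∈-filter⁻ P? {xs = allFin (suc n)} i∈)))))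
          torsion-⊆ : to 0# ∷ torsion M ⊆ periodicPoints
          torsion-⊆ (here ≡.refl) = ∈-filter⁺ P? (∈-allFin _) (0-periodic 1≤t (strictlyInverseʳ 0#))
          torsion-⊆ (there i∈)    = ∈-filter⁺ P? (∈-allFin _) (torsion⇒periodic (∈-torsion⁻ M i∈))
          0∉torsion : ∀ {i} → i ∈ torsion M → to 0# ≢ i
          0∉torsion i∈ ≡.refl = torsion-nonzero M 1≤M (∈-torsion⁻ M i∈) (strictlyInverseʳ 0#)

  -- The cardinality is a variable with an equation because `p ^ n` is not a successor by
  -- computation; matching on the equation makes it one.
  #Per-power : ∀ {c ℓ₁ ℓ₂ s M A t} (K : FiniteField c ℓ₁ ℓ₂ s) → s ≡ suc (M ℕ.* A) →
               1 ≤ M → 1 ≤ A → Coprime M A →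
               1 ≤ t → Coprime t M → (∀ m → 1 ≤ m → Coprime (t ℕ.^ m ∸ 1) A) → #Per K (power K t) ≡ suc M
  #Per-power K ≡.refl 1≤M 1≤A c 1≤t c-t-M c-A = FiniteFieldProperties.#Per-power K ≡.refl 1≤M 1≤A c 1≤t c-t-M c-A

open Arithmetic
open FiniteFields using (#Per-power)
open import Data.Fin using (Fin; zero; suc)
open import Data.Fin.Subset using (Subset; ⊤; _∈_)
open import Data.Fin.Subset.Properties using (∈⊤; _∈?_)
import Data.Integer as ℤ
import Data.Integer.Properties as ℤ
open import Data.Nat as ℕ using (ℕ; zero; suc; _+_; _*_; _∸_; _^_; _≤_; _<_; NonZero; z≤n; s≤s)
open import Data.Nat.Coprimality as Coprimality using (Coprime)
open import Data.Nat.Divisibility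
open import Data.Nat.GCD using (gcd; gcd[m,n]∣n; gcd-greatest)
open import Data.Nat.Primality
open import Data.Nat.Properties as ℕ using (m^n>0; m^n≢0; ^-monoʳ-<)
open import Data.Nat.Tactic.RingSolver using (solve-∀)
open import Data.Product using (∃-syntax; _×_; _,_; proj₁; proj₂)
open import Data.Rational as ℚ using (ℚ; mkℚ; 0ℚ; _-_; ∣_∣; _/_; toℚᵘ; ↧ₙ_) renaming (_<_ to _<ℚ_)
import Data.Rational.Properties as ℚ
open import Data.Rational.Unnormalised as ℚᵘ using (mkℚᵘ; *<*)
import Data.Rational.Unnormalised.Properties as ℚᵘ
open import Data.Vec.Base using ([]; _∷_)
open import Function using (_∘_)
open import Function.Definitions using (Injective)
open import Relation.Binary.PropositionalEquality
open import Relation.Nullary using (¬_; yes; no; contradiction)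

-- Reciprocals in the rationals and the error estimate.

toℚᵘ-/ : ∀ i n .{{_ : NonZero n}} → toℚᵘ (i / n) ℚᵘ.≃ i ℚᵘ./ n
toℚᵘ-/ i (suc n) = ℚ.toℚᵘ-fromℚᵘ (mkℚᵘ i n)

-- Among unnormalised rationals the product has numerator 1 and denominator `m * n` directly, with
-- no reduction to lowest terms.
1/m*1/n≡1/[m*n] : ∀ m n .{{_ : NonZero m}} .{{_ : NonZero n}} →
  let instance _ = ℕ.m*n≢0 m n in (ℤ.+ 1 / m) ℚ.* (ℤ.+ 1 / n) ≡ ℤ.+ 1 / (m * n)
1/m*1/n≡1/[m*n] m@(suc _) n@(suc _) = ℚ.toℚᵘ-injective (ℚᵘ.≃-trans (ℚ.toℚᵘ-homo-* (ℤ.+ 1 / m) (ℤ.+ 1 / n))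
  (ℚᵘ.≃-trans (ℚᵘ.*-cong (toℚᵘ-/ (ℤ.+ 1) m) (toℚᵘ-/ (ℤ.+ 1) n)) (ℚᵘ.≃-sym (toℚᵘ-/ (ℤ.+ 1) (m * n)))))

∏ℕ≢0 : ∀ {r} {x : Fin r → ℕ} (J : Subset r) → (∀ i → NonZero (x i)) → NonZero (∏ℕ J x)
∏ℕ≢0 []          _   = _
∏ℕ≢0 {x = x} (true  ∷ J) x≢0 = ℕ.m*n≢0 (x zero) _ {{x≢0 zero}} {{∏ℕ≢0 J (x≢0 ∘ suc)}}
∏ℕ≢0 (false ∷ J) x≢0 = ∏ℕ≢0 J (x≢0 ∘ suc)

∏ℚ-reciprocal : ∀ {r} (J : Subset r) (x : Fin r → ℕ) (x≢0 : ∀ i → NonZero (x i)) →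
  ∏ℚ J (λ i → (ℤ.+ 1 / x i) {{x≢0 i}}) ≡ (ℤ.+ 1 / ∏ℕ J x) {{∏ℕ≢0 J x≢0}}
∏ℚ-reciprocal []          x x≢0 = refl
∏ℚ-reciprocal (true  ∷ J) x x≢0 = trans
  (cong ((ℤ.+ 1 / x zero) {{x≢0 zero}} ℚ.*_) (∏ℚ-reciprocal J (x ∘ suc) (x≢0 ∘ suc)))
  (1/m*1/n≡1/[m*n] (x zero) _ {{x≢0 zero}} {{∏ℕ≢0 J (x≢0 ∘ suc)}})
∏ℚ-reciprocal (false ∷ J) x x≢0 = ∏ℚ-reciprocal J (x ∘ suc) (x≢0 ∘ suc)

-- (1 + M) / (1 + MA) - 1 / A = (A - 1) / ((1 + MA) A), which is less than 1 / (1 + MA).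
∣[1+M]/[1+MA]-1/A∣<ε : ∀ M A .{{_ : NonZero A}} {ε} → 0ℚ <ℚ ε → ↧ₙ ε < suc (M * A) →
                       ∣ ℤ.+ suc M / suc (M * A) - ℤ.+ 1 / A ∣ <ℚ ε
∣[1+M]/[1+MA]-1/A∣<ε M A@(suc a) {mkℚ (ℤ.+ zero) d _} (ℚ.*<* (ℤ.+<+ ())) _
∣[1+M]/[1+MA]-1/A∣<ε M A@(suc a) {mkℚ ℤ.-[1+ _ ] d _} (ℚ.*<* ()) _
∣[1+M]/[1+MA]-1/A∣<ε M A@(suc a) {ε@(mkℚ (ℤ.+ suc e) d _)} _ d<P =
  ℚ.toℚᵘ-cancel-< (ℚᵘ.<-respˡ-≃ (ℚᵘ.≃-sym difference) (*<* (subst₂ ℤ._<_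
    (ℤ.pos-* a (suc d)) (ℤ.pos-* (suc e) (P * A)) (ℤ.+<+ bound))))
  where
  P = suc (M * A)
  x = ℤ.+ suc M / P
  y = ℤ.+ 1 / A
  numerator : ℤ.+ suc M ℤ.* ℤ.+ A ℤ.+ ℤ.- (ℤ.+ 1) ℤ.* ℤ.+ P ≡ ℤ.+ a
  numerator = begin
    ℤ.+ suc M ℤ.* ℤ.+ A ℤ.+ ℤ.- (ℤ.+ 1) ℤ.* ℤ.+ P  ≡⟨ cong₂ ℤ._+_ (sym (ℤ.pos-* (suc M) A)) (ℤ.-1*i≡-i (ℤ.+ P)) ⟩
    ℤ.+ (suc M * A) ℤ.- ℤ.+ P                      ≡⟨ cong (λ k → ℤ.+ k ℤ.- ℤ.+ P) (identity M a) ⟩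
    ℤ.+ (a + P) ℤ.- ℤ.+ P                          ≡⟨ cong (ℤ._- ℤ.+ P) (ℤ.pos-+ a P) ⟩
    ℤ.+ a ℤ.+ ℤ.+ P ℤ.- ℤ.+ P                      ≡⟨ ℤ.+-assoc (ℤ.+ a) (ℤ.+ P) (ℤ.- ℤ.+ P) ⟩
    ℤ.+ a ℤ.+ (ℤ.+ P ℤ.- ℤ.+ P)                    ≡⟨ cong (λ k → ℤ.+ a ℤ.+ k) (ℤ.+-inverseʳ (ℤ.+ P)) ⟩
    ℤ.+ a ℤ.+ ℤ.+ 0                                ≡⟨ ℤ.+-identityʳ (ℤ.+ a) ⟩
    ℤ.+ a                                          ∎
    where
    open ≡-Reasoning
    identity : ∀ M a → (1 + M) * (1 + a) ≡ a + (1 + M * (1 + a))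
    identity = solve-∀
  difference : toℚᵘ ∣ x - y ∣ ℚᵘ.≃ ℤ.+ a ℚᵘ./ (P * A)
  difference = begin
    toℚᵘ ∣ x - y ∣                                      ≈⟨ ℚ.toℚᵘ-homo-∣-∣ (x - y) ⟩
    ℚᵘ.∣ toℚᵘ (x - y) ∣                                 ≈⟨ ℚᵘ.∣-∣-cong (ℚ.toℚᵘ-homo-+ x (ℚ.- y)) ⟩
    ℚᵘ.∣ toℚᵘ x ℚᵘ.+ toℚᵘ (ℚ.- y) ∣                     ≈⟨ ℚᵘ.∣-∣-cong (ℚᵘ.+-cong (toℚᵘ-/ (ℤ.+ suc M) P) (ℚᵘ.≃-trans (ℚ.toℚᵘ-homo‿- y) (ℚᵘ.-‿cong (toℚᵘ-/ (ℤ.+ 1) A)))) ⟩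
    ℚᵘ.∣ ℤ.+ suc M ℚᵘ./ P ℚᵘ.- ℤ.+ 1 ℚᵘ./ A ∣           ≡⟨ cong (λ k → ℚᵘ.∣ k ℚᵘ./ (P * A) ∣) numerator ⟩
    ℤ.+ a ℚᵘ./ (P * A)                                  ∎
    where open import Relation.Binary.Reasoning.Setoid ℚᵘ.≃-setoid
  -- Here `ε` is `suc e / suc d`. Being positive it is at least `1 / suc d`, which exceeds `1 / P`.
  bound : a * suc d < suc e * (P * A)
  bound = begin-strict
    a * suc d        ≤⟨ ℕ.*-monoʳ-≤ a (ℕ.<⇒≤ d<P) ⟩
    a * P            <⟨ ℕ.*-monoˡ-< P (ℕ.n<1+n a) ⟩
    A * P            ≡⟨ ℕ.*-comm A P ⟩
    P * A            ≤⟨ ℕ.m≤m+n (P * A) (e * (P * A)) ⟩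
    suc e * (P * A)  ∎
    where open ℕ.≤-Reasoning

n<p^n : ∀ {p} → 1 < p → ∀ n → n < p ^ n
n<p^n 1<p zero = s≤s z≤n
n<p^n {p} 1<p (suc n) = ℕ.≤-<-trans (n<p^n 1<p n) (^-monoʳ-< p 1<p (ℕ.n<1+n n))

-- The limit along the admissible exponents.

proposition4p6 :
    ∀ {c ℓ₁ ℓ₂} (r : ℕ) → 1 ≤ r →
    (q : Fin r → ℕ) (q-prime : ∀ i → Prime (q i)) →
    (∀ i → ¬ (2 ∣ q i)) → Injective _≡_ _≡_ q →
    (f : Fin r → ℕ) → (∀ i → 1 ≤ f i) →
    (p : ℕ) (p-prime : Prime p) → (∀ i → p ≢ q i) →
    (δ : Fin r → ℕ) → (∀ i → IsOrd (q i) p (δ i)) →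
    (μ : Fin r → ℕ) → (∀ i → IsValuation (q i) (p ^ δ i ∸ 1) (μ i)) →
    (d : ℕ) → 1 ≤ d → (ν : Fin r → ℕ) →
    let t = ∏ℕ ⊤ (λ i → q i ^ f i)
        Δ = lcmOver ⊤ δ
        Admissible = λ (n : ℕ) → 1 ≤ n × gcd Δ n ≡ d × (∀ i → IsValuation (q i) n (ν i))
    in
    InfinitelyMany Admissible →
    (J : Subset r) → IsMaximalDividing δ d J →
    (ε : ℚ) → 0ℚ <ℚ ε →
    ∃[ N ] (∀ n → N ≤ n → Admissible n → (K : FiniteField c ℓ₁ ℓ₂ (p ^ n)) →
      ∣ #Per K (power K t) /[ p-prime ]^ n - ∏ℚ J (λ j → 1 /[ q-prime j ]^ (μ j + ν j)) ∣ <ℚ ε)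
proposition4p6 r _ q q-prime q-odd q-injective f 1≤f p p-prime p≢q δ ord μ val-μ d _ ν _ J maximal ε 0<ε =
  -- The denominator of `ε` serves as threshold: from there on `p ^ n > n` exceeds it, so the error,
  -- being less than `1 / p ^ n`, is less than `ε`.
  ↧ₙ ε , λ n ε≤n admissible K →
    let M , p^n≡ , 1≤M , q∤M = cofactor n admissible
        #Per≡ = #Per-power K p^n≡ 1≤M (ℕ.>-nonZero⁻¹ A) (Coprimality.sym (coprime-A q∤M))
                  (ℕ.>-nonZero⁻¹ t) (coprime-∏ℕ ⊤ (λ i → coprime-^ (f i) (prime∤⇒coprime (q-prime i) (q∤M i))))
                  (λ m 1≤m → Coprimality.sym (coprime-A (q∤t^m∸1 m 1≤m)))
    in subst (_<ℚ ε)
         (cong₂ (λ x y → ∣ x - y ∣)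
           (ℚ./-cong {{_}} {{m^n≢0 p n}} (cong ℤ.+_ (sym #Per≡)) (sym p^n≡))
           (sym (∏ℚ-reciprocal J a a≢0)))
         (∣[1+M]/[1+MA]-1/A∣<ε M A 0<ε (subst (↧ₙ ε <_) p^n≡ (ℕ.≤-<-trans ε≤n (n<p^n 1<p n))))
  where
  t = ∏ℕ ⊤ (λ i → q i ^ f i)
  Δ = lcmOver ⊤ δ
  a = λ i → q i ^ (μ i + ν i)
  A = ∏ℕ J a

  1<p : 1 < p
  1<p = ℕ.nonTrivial⇒n>1 p {{prime⇒nonTrivial p-prime}}

  q^k≢0 : ∀ i k → NonZero (q i ^ k)
  q^k≢0 i k = m^n≢0 (q i) k {{prime⇒nonZero (q-prime i)}}

  a≢0 : ∀ i → NonZero (a i)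
  a≢0 i = q^k≢0 i (μ i + ν i)

  instance
    p≢0 = prime⇒nonZero p-prime
    A≢0 = ∏ℕ≢0 J a≢0
    t≢0 = ∏ℕ≢0 {x = λ i → q i ^ f i} ⊤ (λ i → q^k≢0 i (f i))

  coprime-A : ∀ {m} → (∀ i → ¬ (q i ∣ m)) → Coprime A m
  coprime-A q∤m = coprime-∏ℕ J (λ i → coprime-^ (μ i + ν i) (prime∤⇒coprime (q-prime i) (q∤m i)))

  a-coprime : ∀ {i j} → i ≢ j → Coprime (a i) (a j)
  a-coprime {i} {j} i≢j = coprime-^ (μ i + ν i) (Coprimality.sym (coprime-^ (μ j + ν j)
    (prime∤⇒coprime (q-prime j) (prime∤prime (q-prime j) (q-prime i) (i≢j ∘ sym ∘ q-injective)))))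

  q∣t : ∀ i → q i ∣ t
  q∣t i = ∣-trans (m∣m^n (f i) (1≤f i)) (∣-∏ℕ {x = λ i → q i ^ f i} ∈⊤)
    where
    m∣m^n : ∀ {m} n → 1 ≤ n → m ∣ m ^ n
    m∣m^n {m} (suc n) _ = m∣m*n (m ^ n)

  -- For positive `m` the prime `q i` divides `t ^ m`, so dividing `t ^ m - 1` as well would make it
  -- divide 1.
  q∤t^m∸1 : ∀ m → 1 ≤ m → ∀ i → ¬ (q i ∣ t ^ m ∸ 1)
  q∤t^m∸1 (suc m) _ i q∣ = prime∤1 (q-prime i) (∣m+n∣m⇒∣n
    (subst (q i ∣_) (trans (sym (ℕ.m+[n∸m]≡n (m^n>0 t (suc m)))) (ℕ.+-comm 1 _)) (∣m⇒∣m*n (t ^ m) (q∣t i))) q∣)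

  -- The prime powers `a i` with `i` in `J` are pairwise coprime and divide `p ^ n - 1`, so `A`
  -- divides it; `M` is the quotient.
  cofactor : ∀ n → 1 ≤ n × gcd Δ n ≡ d × (∀ i → IsValuation (q i) n (ν i)) →
             ∃[ M ] (p ^ n ≡ suc (M * A) × 1 ≤ M × ∀ i → ¬ (q i ∣ M))
  cofactor n (1≤n , gcd≡d , val-ν) = M , p^n≡ , 1≤M M p^n≡ , q∤M
    where
    val : ∀ {i} → i ∈ J → IsValuation (q i) (p ^ n ∸ 1) (μ i + ν i)
    val {i} i∈J = lifting-the-exponent p-prime (q-prime i) (p≢q i) (ord i) (q-odd i) (μ i) (ν i) (val-μ i) (val-ν i)
      (∣-trans (maximal⇒∣ maximal i∈J) (subst (_∣ n) gcd≡d (gcd[m,n]∣n Δ n)))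

    A∣ : A ∣ p ^ n ∸ 1
    A∣ = ∏ℕ-∣ J a-coprime (λ i∈J → proj₁ (val i∈J))

    M = quotient A∣

    p^n≡ : p ^ n ≡ suc (M * A)
    p^n≡ = trans (sym (ℕ.m+[n∸m]≡n (m^n>0 p n))) (cong suc (_∣_.equality A∣))

    1≤M : ∀ M → p ^ n ≡ suc (M * A) → 1 ≤ M
    1≤M zero    p^n≡1 = contradiction p^n≡1 (ℕ.>⇒≢ (ℕ.≤-<-trans 1≤n (n<p^n 1<p n)))
    1≤M (suc _) _     = s≤s z≤n

    q∤M : ∀ i → ¬ (q i ∣ M)
    q∤M i q∣M with i ∈? J
    -- The factor `A` already carries the full valuation of `p ^ n - 1` at `q i`; one more factor
    -- from `M` would exceed it.
    ... | yes i∈J = proj₂ (val i∈J) (subst (q i ^ suc (μ i + ν i) ∣_) (sym (_∣_.equality A∣)) (*-pres-∣ q∣M (∣-∏ℕ {x = a} i∈J)))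
    -- If `q i` divided `p ^ n - 1`, the order `δ i` would divide `n` and `Δ`, hence their gcd `d`,
    -- placing `i` in `J`.
    ... | no  i∉J = i∉J (∣⇒maximal maximal (subst (δ i ∣_) gcd≡d (gcd-greatest (∣-lcmOver {x = δ} ∈⊤)
      (order-∣ p-prime (q-prime i) (p≢q i) (ord i) (∣-trans q∣M (quotient-∣ A∣))))))
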